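{- Let $n=32$ and let the cities $1,\dots,32$ be partitioned into four valleys $A=\{1,\dots,4\}$, $B=\{5,\dots,16\}$, $C=\{17,\dots,28\}$, $D=\{29,\dots,32\}$. For cities $i\neq j$ let $c_{ij}=1$ if $i$ and $j$ lie in the same valley and $c_{ij}=1000$ otherwise. Then the linear program BLP defined in the context has a feasible real-valued solution $(y,z)$ whose cost $$\sum_{s=1}^{32}\ \sum_{\substack{i,j\in\{1,\dots,32\}\\ i\neq j}} c_{ij}\, y_{i,s,j,i,s,j}$$ is strictly smaller than the minimum cost, with respect to $c$, of a travelling salesman tour (a directed Hamiltonian cycle) on the cities $1,\dots,32$. In particular, the optimal value of BLP is not equal to the optimal value of the travelling salesman problem for this instance.
   Context: Fix $n\ge 1$ and put $N=\{1,\dots,n\}$. Cities and stages are both indexed by $N$. A triple $(i,s,j)\in N^3$ stands for "travel from city $i$ to city $j$ at stage $s$". The cost of a directed Hamiltonian cycle is the sum of $c_{ij}$ over its $n$ arcs $(i,j)$. The linear program BLP has real variables $y_{i,s,j,u,p,v}$ (for all $i,s,j,u,p,v\in N$) and $z_{i,s,j,u,p,v,k,r,t}$ (for all $i,s,j,u,p,v,k,r,t\in N$), all lying in $[0,1]$. Forbidden pairs. Call the ordered pair of triples $\big((i,s,j),(u,p,v)\big)$ forbidden if at least one of the following holds: (a) $i=j$ or $u=v$; (b) $p<s$; (c) $p=s$ and $(i,j)\ne(u,v)$; (d) $p=s+1$ and $j\neq u$; (e) $p>s$ and $i=v$, except that this condition is not imposed when $s=1$ and $p=n$ (so that the last arc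 may return to the starting city of the first arc); (f) $p>s$ and $i=u$; (g) $p>s$ and $j=v$; (h) $p>s+1$ and $j=u$. A point $(y,z)$ is feasible for BLP if all variables lie in $[0,1]$ and the following constraints hold. 1. $y_{i,s,j,u,p,v}=0$ whenever $\big((i,s,j),(u,p,v)\big)$ is forbidden. Moreover $z_{i,s,j,u,p,v,k,r,t}=0$ unless $s<p<r$ and none of the three pairs $\big((i,s,j),(u,p,v)\big)$, $\big((i,s,j),(k,r,t)\big)$, $\big((u,p,v),(k,r,t)\big)$ is forbidden. 2. $\sum_{i,j\in N} y_{i,1,j,i,1,j}=1$. 3. $y_{i,s,j,i,s,j}=\sum_{u,v\in N} y_{u,1,v,i,s,j}$ for all $i,j\in N$ and $2\le s\le n$. 4. $\sum_{k\in N} y_{i,s,j,k,r,t}=\sum_{k\in N} y_{i,s,j,t,r+1,k}$ for all $i,j,t\in N$ and all $1\le s\le r\le n-1$. 5. $\sum_{k,t\in N} z_{i,s,j,u,p,v,k,r,t}=y_{i,s,j,u,p,v}$ for all $i,j,u,v\in N$ and all $1\le s<p<r\le n$. 6. $\sum_{u,v\in N} z_{i,s,j,u,p,v,k,r,t}=y_{i,s,j,k,r,t}$ for all $i,j,k,t\in N$ and all $1\le s<p<r\le n$. 7. $\sum_{i,j\in N} z_{i,s,j,u,p,v,k,r,t}=y_{u,p,v,k,r,t}$ for all $u,v,k,t\in N$ and all $1\le s<p<r\le n$. -}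

module Defs where

open import Algebra.Bundles using (CommutativeMonoid; RawMonoid)
import Algebra.Definitions.RawMonoid as RawMonoidOps
import Algebra.Properties.CommutativeSemigroup as CommutativeSemigroup
open import Data.Bool.Base using (if_then_else_)
open import Data.Fin.Base using (Fin; toℕ)
open import Data.Fin.Patterns using (0F; 1F; 2F; 3F)
open import Data.Fin.Permutation using (Permutation′; _⟨$⟩ʳ_)
import Data.Fin.Properties as Fin
open import Data.Integer.Base using (+_)
open import Data.Nat.Base as ℕ using (ℕ; suc; NonZero)
open import Data.Nat.DivMod using (_mod_)
import Data.Nat.Properties as ℕ
open import Data.Product.Base using (_×_; _,_; ∃-syntax)
open import Data.Rational.Base as ℚ using (ℚ; 0ℚ; ½; Positive)
import Data.Rational.Properties as ℚ
open import Data.Sum.Base using (_⊎_)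
open import Level using (0ℓ)
open import Relation.Binary.PropositionalEquality
  using (_≡_; _≢_; sym; trans; cong; subst)
open import Relation.Nullary using (¬_; does)

------------------------------------------------------------------------
-- Real numbers: Cauchy sequences of rationals, up to _≈_

record ℝ : Set where
  constructor mkℝ
  field
    seq    : ℕ → ℚ
    cauchy : ∀ (ε : ℚ) .{{_ : Positive ε}} →
             ∃[ K ] (∀ m n → K ℕ.≤ m → K ℕ.≤ n →
                     ℚ.∣ seq m ℚ.- seq n ∣ ℚ.≤ ε)

open ℝ public

module Real where

  infix 4 _≈_ _≤_ _<_
  infixl 6 _+_

  _≈_ _≤_ _<_ : ℝ → ℝ → Set
  x ≈ y = ∀ (ε : ℚ) .{{_ : Positive ε}} →
          ∃[ K ] (∀ n → K ℕ.≤ n → ℚ.∣ seq x n ℚ.- seq y n ∣ ℚ.≤ ε)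
  x ≤ y = ∀ (ε : ℚ) .{{_ : Positive ε}} →
          ∃[ K ] (∀ n → K ℕ.≤ n → seq x n ℚ.≤ seq y n ℚ.+ ε)
  x < y = ∃[ ε ] Positive ε × ∃[ K ] (∀ n → K ℕ.≤ n → seq x n ℚ.+ ε ℚ.≤ seq y n)

  fromℚ : ℚ → ℝ
  seq    (fromℚ q) _ = q
  cauchy (fromℚ q) ε = 0 , λ _ _ _ _ →
    subst (ℚ._≤ ε) (sym (cong ℚ.∣_∣ (ℚ.+-inverseʳ q)))
          (ℚ.<⇒≤ (ℚ.positive⁻¹ ε))

  fromℕ : ℕ → ℝ
  fromℕ k = fromℚ (+ k ℚ./ 1)

  0ℝ 1ℝ : ℝ
  0ℝ = fromℕ 0
  1ℝ = fromℕ 1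

  private
    regroup : ∀ a b c d → (a ℚ.- c) ℚ.+ (b ℚ.- d) ≡ (a ℚ.+ b) ℚ.- (c ℚ.+ d)
    regroup a b c d = trans
      (interchange a (ℚ.- c) b (ℚ.- d))
      (cong ((a ℚ.+ b) ℚ.+_) (sym (ℚ.neg-distrib-+ c d)))
      where
      open CommutativeSemigroup
        (CommutativeMonoid.commutativeSemigroup ℚ.+-0-commutativeMonoid)
        using (interchange)

    halves : ∀ ε → ½ ℚ.* ε ℚ.+ ½ ℚ.* ε ≡ ε
    halves ε = trans (sym (ℚ.*-distribʳ-+ ε ½ ½)) (ℚ.*-identityˡ ε)

  _+_ : ℝ → ℝ → ℝ
  seq    (x + y) n = seq x n ℚ.+ seq y n
  cauchy (x + y) ε
    with cauchy x (½ ℚ.* ε) {{ℚ.pos*pos⇒pos ½ ε}}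
       | cauchy y (½ ℚ.* ε) {{ℚ.pos*pos⇒pos ½ ε}}
  ... | K , p | L , q = K ℕ.⊔ L , λ m n h k → begin
    ℚ.∣ (seq x m ℚ.+ seq y m) ℚ.- (seq x n ℚ.+ seq y n) ∣
      ≡⟨ cong ℚ.∣_∣ (regroup (seq x m) (seq y m) (seq x n) (seq y n)) ⟨
    ℚ.∣ (seq x m ℚ.- seq x n) ℚ.+ (seq y m ℚ.- seq y n) ∣
      ≤⟨ ℚ.∣p+q∣≤∣p∣+∣q∣ (seq x m ℚ.- seq x n) (seq y m ℚ.- seq y n) ⟩
    ℚ.∣ seq x m ℚ.- seq x n ∣ ℚ.+ ℚ.∣ seq y m ℚ.- seq y n ∣
      ≤⟨ ℚ.+-mono-≤ (p m n (ℕ.m⊔n≤o⇒m≤o K L h) (ℕ.m⊔n≤o⇒m≤o K L k))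
                    (q m n (ℕ.m⊔n≤o⇒n≤o K L h) (ℕ.m⊔n≤o⇒n≤o K L k)) ⟩
    ½ ℚ.* ε ℚ.+ ½ ℚ.* ε
      ≡⟨ halves ε ⟩
    ε ∎
    where open ℚ.≤-Reasoning

  +-0-rawMonoid : RawMonoid 0ℓ 0ℓ
  +-0-rawMonoid = record { Carrier = ℝ ; _≈_ = _≈_ ; _∙_ = _+_ ; ε = 0ℝ }

  -- Costs are natural numbers, so a cost times a real is a natural multiple.
  open RawMonoidOps +-0-rawMonoid public using (sum) renaming (_×_ to _·_)

  infixl 10 sum-syntax
  sum-syntax : ∀ n → (Fin n → ℝ) → ℝ
  sum-syntax _ = sum

  syntax sum-syntax n (λ i → x) = ∑[ i < n ] x

  IsInfimum : ∀ {X : Set} → (X → ℝ) → ℝ → Set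
  IsInfimum f v = (∀ x → v ≤ f x) × (∀ w → (∀ x → w ≤ f x) → w ≤ v)

open Real using (_≈_; 0ℝ; 1ℝ; _·_; sum-syntax; IsInfimum)

------------------------------------------------------------------------
-- The linear program BLP and the travelling salesman problem

-- The elements of N = {1,…,n} are represented by Fin n; # recovers the
-- 1-based number.
# : ∀ {n} → Fin n → ℕ
# i = suc (toℕ i)

module _ (n : ℕ) where

  -- (i , s , j) : travel from city i to city j at stage s.
  Triple : Set
  Triple = Fin n × Fin n × Fin n

  data Forbidden : Triple → Triple → Set where
    loop      : ∀ {i s j u p v} → i ≡ j ⊎ u ≡ v →
                Forbidden (i , s , j) (u , p , v)
    backward  : ∀ {i s j u p v} → # p ℕ.< # s →
                Forbidden (i , s , j) (u , p , v)
    clash     : ∀ {i s j u p v} → # p ≡ # s → (i , j) ≢ (u , v) →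
                Forbidden (i , s , j) (u , p , v)
    broken    : ∀ {i s j u p v} → # p ≡ # s ℕ.+ 1 → j ≢ u →
                Forbidden (i , s , j) (u , p , v)
    closing   : ∀ {i s j u p v} → # p ℕ.> # s → i ≡ v →
                ¬ (# s ≡ 1 × # p ≡ n) →
                Forbidden (i , s , j) (u , p , v)
    releaving : ∀ {i s j u p v} → # p ℕ.> # s → i ≡ u →
                Forbidden (i , s , j) (u , p , v)
    reentry   : ∀ {i s j u p v} → # p ℕ.> # s → j ≡ v →
                Forbidden (i , s , j) (u , p , v)
    revisit   : ∀ {i s j u p v} → # p ℕ.> # s ℕ.+ 1 → j ≡ u →
                Forbidden (i , s , j) (u , p , v)

  record Point : Set where
    field
      y : Triple → Triple → ℝ
      z : Triple → Triple → Triple → ℝ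

  InUnitInterval : ℝ → Set
  InUnitInterval x = 0ℝ Real.≤ x × x Real.≤ 1ℝ

  record Feasible (P : Point) : Set where
    open Point P
    field
      y-bounds : ∀ a b → InUnitInterval (y a b)
      z-bounds : ∀ a b c → InUnitInterval (z a b c)

      y-zero : ∀ a b → Forbidden a b → y a b ≈ 0ℝ
      z-zero : ∀ i s j u p v k r t →
               ¬ ((# s ℕ.< # p × # p ℕ.< # r)
                  × ¬ Forbidden (i , s , j) (u , p , v)
                  × ¬ Forbidden (i , s , j) (k , r , t)
                  × ¬ Forbidden (u , p , v) (k , r , t)) →
               z (i , s , j) (u , p , v) (k , r , t) ≈ 0ℝ

      initial : ∀ s → # s ≡ 1 →
                ∑[ i < n ] ∑[ j < n ] y (i , s , j) (i , s , j) ≈ 1ℝ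

      spread : ∀ i j s s₁ → # s₁ ≡ 1 → 2 ℕ.≤ # s →
               y (i , s , j) (i , s , j)
                 ≈ ∑[ u < n ] ∑[ v < n ] y (u , s₁ , v) (i , s , j)

      -- The existence of r⁺ with # r⁺ ≡ # r + 1 says that r ≤ n - 1.
      flow : ∀ i j t s r r⁺ → # s ℕ.≤ # r → # r⁺ ≡ # r ℕ.+ 1 →
             ∑[ k < n ] y (i , s , j) (k , r , t)
               ≈ ∑[ k < n ] y (i , s , j) (t , r⁺ , k)

      marginal₃ : ∀ i j u v s p r → # s ℕ.< # p → # p ℕ.< # r →
                  ∑[ k < n ] ∑[ t < n ] z (i , s , j) (u , p , v) (k , r , t)
                    ≈ y (i , s , j) (u , p , v)

      marginal₂ : ∀ i j k t s p r → # s ℕ.< # p → # p ℕ.< # r →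
                  ∑[ u < n ] ∑[ v < n ] z (i , s , j) (u , p , v) (k , r , t)
                    ≈ y (i , s , j) (k , r , t)

      marginal₁ : ∀ u v k t s p r → # s ℕ.< # p → # p ℕ.< # r →
                  ∑[ i < n ] ∑[ j < n ] z (i , s , j) (u , p , v) (k , r , t)
                    ≈ y (u , p , v) (k , r , t)

  FeasiblePoint : Set
  FeasiblePoint = ∃[ P ] Feasible P

  module _ (c : Fin n → Fin n → ℕ) where

    blpCost : FeasiblePoint → ℝ
    blpCost (P , _) =
      ∑[ s < n ] ∑[ i < n ] ∑[ j < n ]
        (if does (i Fin.≟ j)
           then 0ℝ
           else c i j · Point.y P (i , s , j) (i , s , j))

    IsBLPOptimum : ℝ → Set
    IsBLPOptimum = IsInfimum blpCost

  -- A tour is given by the order σ in which the cities are visited; its arcs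
  -- are (σ k , σ (k + 1)) with positions taken modulo n.
  Tour : Set
  Tour = Permutation′ n

  module _ .{{_ : NonZero n}} (c : Fin n → Fin n → ℕ) where

    tourCost : Tour → ℕ
    tourCost σ = RawMonoidOps.sum ℕ.+-0-rawMonoid
      (λ (k : Fin n) → c (σ ⟨$⟩ʳ k) (σ ⟨$⟩ʳ (suc (toℕ k) mod n)))

    IsMinTourCost : ℕ → Set
    IsMinTourCost m = (∃[ σ ] tourCost σ ≡ m) × (∀ σ → m ℕ.≤ tourCost σ)

------------------------------------------------------------------------
-- The instance with four valleys

valley : Fin 32 → Fin 4
valley i = if does (# i ℕ.≤? 4)  then 0F else
           if does (# i ℕ.≤? 16) then 1F else
           if does (# i ℕ.≤? 28) then 2F else 3F

-- The diagonal values are irrelevant: blpCost skips them and a tour on 32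
-- cities has no arc from a city to itself.
valleyCost : Fin 32 → Fin 32 → ℕ
valleyCost i j = if does (valley i Fin.≟ valley j) then 1 else 1000

{-# OPTIONS --safe #-}

-- No constraint of BLP forces every city to be visited: the constraints only
-- concern three arcs at a time, hence at most six cities.  Fix six cities
-- inside one valley, and let y and z at given arcs be the proportion of the
-- 6! orderings of these cities that begin with the cities listed by the arcs,
-- where consecutive arcs share a city.  Summing out an arc sums out its new
-- cities, so all marginals agree, and every stage costs 1: the total is 32.
-- A tour leaves each of the four valleys, so it costs at least 28 + 4 · 1000.

module Submission where

open import Defs
import Algebra.Properties.CommutativeMonoid.Sum as CommutativeMonoidSum
import Algebra.Properties.AbelianGroup as AbelianGroupProperties
import Algebra.Properties.Monoid.Mult as MonoidMult
open import Data.Bool.Base using (Bool; true; false; if_then_else_)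
import Data.Bool.Properties as Bool
open import Data.Bool.Properties using (if-swap-then)
open import Data.Fin.Base using (Fin; zero; suc; toℕ; punchIn)
open import Data.Fin.Patterns using (0F; 1F; 2F; 3F)
open import Data.Fin.Permutation using (_⟨$⟩ʳ_; _⟨$⟩ˡ_; inverseʳ)
import Data.Fin.Permutation as Perm
import Data.Fin.Properties as Fin
open import Data.Fin.Subset using (Subset; inside; outside; ∣_∣)
import Data.Integer.Base as ℤ
open import Data.List.Base using (List; []; _∷_; _++_; length)
open import Data.List.Membership.Propositional using (_∈_)
open import Data.List.Relation.Unary.Any using (here; there)
open import Data.Nat.Base as ℕ
  using (ℕ; zero; suc; _+_; _*_; _!; _≤_; _<_; z≤n; s≤s; nonZero; NonZero)
open import Data.Nat.DivMod using (_mod_; _%_)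
import Data.Nat.DivMod as DivMod
import Data.Nat.Properties as ℕ
open import Data.Product.Base using (_×_; _,_; proj₁; proj₂; ∃-syntax)
open import Data.Rational.Base as ℚ using (ℚ; 0ℚ; 1ℚ; ½)
import Data.Rational.Properties as ℚ
open import Data.Sum.Base using (inj₁; inj₂)
open import Data.Vec.Base using ([]; _∷_; lookup; tabulate; _[_]≔_)
open import Data.Vec.Properties
  using (lookup∘update; lookup∘update′; []≔-commutes)
open import Function.Base using (_∘_)
open import Relation.Binary.Definitions using (DecidableEquality)
open import Relation.Binary.PropositionalEquality
open import Relation.Nullary using (¬_; does; yes; no; contradiction)
open import Relation.Nullary.Decidable
  using (True; toWitness; dec-true; dec-false; decidable-stable; ¬?; _×-dec_; _→-dec_)

open Real using (_≈_; 0ℝ; 1ℝ; _·_; IsInfimum)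
open CommutativeMonoidSum ℕ.+-0-commutativeMonoid
  using (sum; sum-syntax; sum-cong-≗; ∑-distrib-+; ∑-comm; sum-replicate-zero)
open AbelianGroupProperties ℚ.+-0-abelianGroup using (xyx⁻¹≈y; ⁻¹-anti-homo-//)
open MonoidMult ℚ.+-0-monoid using (×-homo-+; ×-assocˡ) renaming (_×_ to _×ℚ_)

-- Sums of natural numbers

when : Bool → ℕ → ℕ
when b w = if b then w else 0

when-0 : ∀ b → when b 0 ≡ 0
when-0 true  = refl
when-0 false = refl

when-≤ : ∀ b w → when b w ≤ w
when-≤ true  w = ℕ.≤-refl
when-≤ false w = z≤n

sum-0 : ∀ {n} {f : Fin n → ℕ} → (∀ i → f i ≡ 0) → sum f ≡ 0
sum-0 {n} f≗0 = trans (sum-cong-≗ f≗0) (sum-replicate-zero n)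

sum-when : ∀ n b (f : Fin n → ℕ) → ∑[ i < n ] when b (f i) ≡ when b (sum f)
sum-when n true  f = refl
sum-when n false f = sum-0 {n} (λ _ → refl)

sum-≟ˡ : ∀ {n} (j : Fin n) (f : Fin n → ℕ) →
         ∑[ i < n ] when (does (j Fin.≟ i)) (f i) ≡ f j
sum-≟ˡ {suc n} zero    f =
  trans (cong (f zero +_) (sum-0 {n} (λ _ → refl))) (ℕ.+-identityʳ _)
sum-≟ˡ         (suc j) f = sum-≟ˡ j (f ∘ suc)

sum-≟ʳ : ∀ {n} (j : Fin n) (f : Fin n → ℕ) →
         ∑[ i < n ] when (does (i Fin.≟ j)) (f i) ≡ f j
sum-≟ʳ {suc n} zero    f =
  trans (cong (f zero +_) (sum-0 {n} (λ _ → refl))) (ℕ.+-identityʳ _)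
sum-≟ʳ         (suc j) f = sum-≟ʳ j (f ∘ suc)

sum-mono-≤ : ∀ {n} {f g : Fin n → ℕ} → (∀ i → f i ≤ g i) → sum f ≤ sum g
sum-mono-≤ {zero}  f≤g = z≤n
sum-mono-≤ {suc n} f≤g = ℕ.+-mono-≤ (f≤g zero) (sum-mono-≤ (f≤g ∘ suc))

term≤sum : ∀ {n} (f : Fin n → ℕ) i → f i ≤ sum f
term≤sum f zero    = ℕ.m≤m+n _ _
term≤sum f (suc i) = ℕ.≤-trans (term≤sum (f ∘ suc) i) (ℕ.m≤n+m _ _)

sum-const : ∀ n c → ∑[ i < n ] c ≡ n * c
sum-const zero    c = refl
sum-const (suc n) c = cong (c +_) (sum-const n c)

-- Orderings of a set of cities with given initial cities

sum-lookup : ∀ {n} (S : Subset n) w → ∑[ i < n ] when (lookup S i) w ≡ ∣ S ∣ * w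
sum-lookup []            w = refl
sum-lookup (inside  ∷ S) w = cong (w +_) (sum-lookup S w)
sum-lookup (outside ∷ S) w = sum-lookup S w

remove : ∀ {n} → Subset n → Fin n → Subset n
remove S x = S [ x ]≔ outside

∣remove∣ : ∀ {n} (S : Subset n) x → lookup S x ≡ inside → ∣ S ∣ ≡ suc ∣ remove S x ∣
∣remove∣ (inside  ∷ S) zero    refl = refl
∣remove∣ (inside  ∷ S) (suc x) x∈S  = cong suc (∣remove∣ S x x∈S)
∣remove∣ (outside ∷ S) (suc x) x∈S  = ∣remove∣ S x x∈S

-- Each listed city is removed before the next one is tested, so a list that repeats a city or
-- leaves `S` counts zero. The final factorial counts the ways to order the cities that remain.
orderings : ∀ {n} → Subset n → List (Fin n) → ℕ
orderings S []      = ∣ S ∣ !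
orderings S (x ∷ L) = when (lookup S x) (orderings (remove S x) L)

-- Removals at distinct places commute and do not affect each other's membership tests. This lets a
-- summed city move past the listed ones.
orderings-swap : ∀ {n} (S : Subset n) x y L →
                 orderings S (x ∷ y ∷ L) ≡ orderings S (y ∷ x ∷ L)
orderings-swap S x y L with x Fin.≟ y
... | yes refl = refl
... | no  x≢y  = begin
  when (lookup S x) (when (lookup (remove S x) y) w)
    ≡⟨ cong (λ b → when (lookup S x) (when b w)) (lookup∘update′ (x≢y ∘ sym) S outside) ⟩
  when (lookup S x) (when (lookup S y) w)
    ≡⟨ if-swap-then (lookup S x) (lookup S y) ⟩
  when (lookup S y) (when (lookup S x) w)
    ≡⟨ cong₂ (λ b T → when (lookup S y) (when b (orderings T L)))
             (sym (lookup∘update′ x≢y S outside)) ([]≔-commutes S x y x≢y) ⟩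
  when (lookup S y) (when (lookup (remove S y) x) (orderings (remove (remove S y) x) L)) ∎
  where
  open ≡-Reasoning
  w = orderings (remove (remove S x) y) L

-- The summed city moves behind the head `x` by a swap, and induction runs in `remove S x`. For the
-- empty list there are `∣ S ∣` choices, each leaving one city fewer to order. The length bound
-- guarantees that a city is left to choose.
sum-orderings-∷ : ∀ {n} (S : Subset n) L → length L < ∣ S ∣ →
                  ∑[ u < n ] orderings S (u ∷ L) ≡ orderings S L
sum-orderings-∷ {n} S [] 0<∣S∣ = begin
  ∑[ u < n ] when (lookup S u) (∣ remove S u ∣ !)   ≡⟨ sum-cong-≗ remaining ⟩
  ∑[ u < n ] when (lookup S u) (ℕ.pred ∣ S ∣ !)     ≡⟨ sum-lookup S _ ⟩
  ∣ S ∣ * ℕ.pred ∣ S ∣ !                            ≡⟨ n*[n-1]! 0<∣S∣ ⟩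
  ∣ S ∣ !                                           ∎
  where
  open ≡-Reasoning
  remaining : ∀ u → when (lookup S u) (∣ remove S u ∣ !) ≡ when (lookup S u) (ℕ.pred ∣ S ∣ !)
  remaining u with lookup S u in u∈S
  ... | true  = cong (λ m → ℕ.pred m !) (sym (∣remove∣ S u u∈S))
  ... | false = refl
  n*[n-1]! : ∀ {m} → 0 < m → m * ℕ.pred m ! ≡ m !
  n*[n-1]! (s≤s _) = refl
sum-orderings-∷ {n} S (x ∷ L) ∣L∣<∣S∣ = begin
  ∑[ u < n ] orderings S (u ∷ x ∷ L)
    ≡⟨ sum-cong-≗ (λ u → orderings-swap S u x L) ⟩
  ∑[ u < n ] when (lookup S x) (orderings (remove S x) (u ∷ L))
    ≡⟨ sum-when n (lookup S x) _ ⟩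
  when (lookup S x) (∑[ u < n ] orderings (remove S x) (u ∷ L))
    ≡⟨ removed ⟩
  when (lookup S x) (orderings (remove S x) L) ∎
  where
  open ≡-Reasoning
  removed : when (lookup S x) (∑[ u < n ] orderings (remove S x) (u ∷ L))
            ≡ when (lookup S x) (orderings (remove S x) L)
  removed with lookup S x in x∈S
  ... | true  = sum-orderings-∷ (remove S x) L
                  (ℕ.s<s⁻¹ (subst (length (x ∷ L) <_) (∣remove∣ S x x∈S) ∣L∣<∣S∣))
  ... | false = refl

-- The tests for the cities of `L` do not involve the summed city, so they come out of the sum one
-- at a time. This is the source of every marginal identity below.
sum-orderings : ∀ {n} (S : Subset n) L M → length (L ++ M) < ∣ S ∣ →
                ∑[ u < n ] orderings S (L ++ u ∷ M) ≡ orderings S (L ++ M)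
sum-orderings S []      M ∣M∣<∣S∣ = sum-orderings-∷ S M ∣M∣<∣S∣
sum-orderings {n} S (x ∷ L) M ∣L∣<∣S∣ =
  trans (sum-when n (lookup S x) _) removed
  where
  removed : when (lookup S x) (∑[ u < _ ] orderings (remove S x) (L ++ u ∷ M))
            ≡ when (lookup S x) (orderings (remove S x) (L ++ M))
  removed with lookup S x in x∈S
  ... | true  = sum-orderings (remove S x) L M
                  (ℕ.s<s⁻¹ (subst (length (x ∷ L ++ M) <_) (∣remove∣ S x x∈S) ∣L∣<∣S∣))
  ... | false = refl

orderings≤ : ∀ {n} (S : Subset n) L → orderings S L ≤ ∣ S ∣ !
orderings≤ S []      = ℕ.≤-refl
orderings≤ S (x ∷ L) with lookup S x in x∈S
... | false = z≤n
... | true  = ℕ.≤-trans (orderings≤ (remove S x) L)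
    (subst (λ m → ∣ remove S x ∣ ! ≤ m !) (sym (∣remove∣ S x x∈S)) (ℕ.m≤m+n _ _))

orderings-absent : ∀ {n} (S : Subset n) {x} L → lookup S x ≡ outside → x ∈ L →
                   orderings S L ≡ 0
orderings-absent S (_ ∷ _) x∉S (here refl) rewrite x∉S = refl
orderings-absent S {x} (y ∷ L) x∉S (there x∈L) =
  trans (cong (when (lookup S y)) (orderings-absent (remove S y) L absent x∈L)) (when-0 (lookup S y))
  where
  absent : lookup (remove S y) x ≡ outside
  absent with x Fin.≟ y
  ... | yes refl = lookup∘update x S outside
  ... | no  x≢y  = trans (lookup∘update′ x≢y S outside) x∉S

data Repeats {A : Set} : List A → Set where
  head : ∀ {x L} → x ∈ L → Repeats (x ∷ L)
  tail : ∀ {x L} → Repeats L → Repeats (x ∷ L)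

orderings-repeats : ∀ {n} (S : Subset n) L → Repeats L → orderings S L ≡ 0
orderings-repeats S (x ∷ L) (head x∈L) = trans
  (cong (when (lookup S x)) (orderings-absent (remove S x) L (lookup∘update x S outside) x∈L))
  (when-0 (lookup S x))
orderings-repeats S (x ∷ L) (tail r)   =
  trans (cong (when (lookup S x)) (orderings-repeats (remove S x) L r)) (when-0 (lookup S x))

-- Gaps between stages

data Link : Set where
  adjacent distant : Link

-- The weights depend on two stages only through this comparison. `distant` covers all differences
-- of at least two, where the two arcs have four different cities.
data Gap : Set where
  behind same : Gap
  ahead       : Link → Gap

gap : ℕ → ℕ → Gap
gap zero    zero          = same
gap zero    (suc zero)    = ahead adjacent
gap zero    (suc (suc _)) = ahead distant
gap (suc _) zero          = behind
gap (suc s) (suc p)       = gap s p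

-- The effect of moving the later stage one step on, as needed for the flow constraint.
grow : Gap → Gap
grow behind    = behind
grow same      = ahead adjacent
grow (ahead _) = ahead distant

gap-> : ∀ {s p} → p < s → gap s p ≡ behind
gap-> {p = zero}  (s≤s _)   = refl
gap-> {p = suc p} (s≤s p<s) = gap-> p<s

gap-≡ : ∀ {s p} → p ≡ s → gap s p ≡ same
gap-≡ {zero}  refl = refl
gap-≡ {suc s} refl = gap-≡ {s} refl

gap-suc : ∀ {s p} → s ≤ p → gap s (suc p) ≡ grow (gap s p)
gap-suc {p = zero}        z≤n       = refl
gap-suc {p = suc zero}    z≤n       = refl
gap-suc {p = suc (suc p)} z≤n       = refl
gap-suc                   (s≤s s≤p) = gap-suc s≤p

gap-+1 : ∀ {s p p⁺} → s ≤ p → p⁺ ≡ p + 1 → gap s p⁺ ≡ grow (gap s p)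
gap-+1 {s} {p} s≤p p⁺≡p+1 =
  trans (cong (gap s) (trans p⁺≡p+1 (ℕ.+-comm p 1))) (gap-suc s≤p)

gap-< : ∀ {s p} → s < p → ∃[ l ] gap s p ≡ ahead l
gap-< {zero}  {suc zero}    _         = adjacent , refl
gap-< {zero}  {suc (suc p)} _         = distant , refl
gap-< {suc s}               (s≤s s<p) = gap-< s<p

gap-<1+ : ∀ {s p} → suc s < p → gap s p ≡ ahead distant
gap-<1+ {zero}  (s≤s (s≤s _)) = refl
gap-<1+ {suc s} (s≤s s<p)     = gap-<1+ s<p

gap-<< : ∀ {s p r} → s < p → p < r → gap s r ≡ ahead distant
gap-<< s<p p<r = gap-<1+ (ℕ.≤-<-trans s<p p<r)

gap-ahead : ∀ s p {l} → gap s p ≡ ahead l → s < p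
gap-ahead zero    (suc p) _  = s≤s z≤n
gap-ahead (suc s) (suc p) eq = s≤s (gap-ahead s p eq)

-- Weights of pairs and triples of arcs, in units of 1/720.

module Weights {n} (S : Subset n) (∣S∣≡6 : ∣ S ∣ ≡ 6) where

  -- Between adjacent stages the cities j and u coincide and are listed once.
  joined : Link → Fin n → Fin n → (List (Fin n) → ℕ) → ℕ
  joined adjacent j u w = when (does (j Fin.≟ u)) (w [])
  joined distant  j u w = w (u ∷ [])

  pairWeight : Gap → (i j u v : Fin n) → ℕ
  pairWeight behind    i j u v = 0
  pairWeight same      i j u v =
    when (does (i Fin.≟ u)) (when (does (j Fin.≟ v)) (orderings S (i ∷ j ∷ [])))
  pairWeight (ahead l) i j u v =
    joined l j u λ m → orderings S (i ∷ j ∷ m ++ v ∷ [])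

  tripleWeight : Gap → Gap → (i j u v k t : Fin n) → ℕ
  tripleWeight (ahead l) (ahead l′) i j u v k t =
    joined l j u λ m → joined l′ v k λ m′ → orderings S (i ∷ j ∷ m ++ v ∷ m′ ++ t ∷ [])
  tripleWeight _ _ _ _ _ _ _ _ = 0

  ∑² : (Fin n → Fin n → ℕ) → ℕ
  ∑² f = ∑[ u < n ] ∑[ v < n ] f u v

  ∑²-cong : ∀ {f g : Fin n → Fin n → ℕ} → (∀ u v → f u v ≡ g u v) → ∑² f ≡ ∑² g
  ∑²-cong eq = sum-cong-≗ (λ u → sum-cong-≗ (eq u))

  term≤∑² : ∀ (f : Fin n → Fin n → ℕ) u v → f u v ≤ ∑² f
  term≤∑² f u v = ℕ.≤-trans (term≤sum (f u) v) (term≤sum (λ u → sum (f u)) u)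

  -- This is where six cities are needed: three pairwise distant arcs list six cities, so at most
  -- five stay fixed while one is summed. The bound is decided by computation on lists of explicit
  -- length.
  extend : ∀ L M {_ : True (length (L ++ M) ℕ.<? 6)} →
           ∑[ u < n ] orderings S (L ++ u ∷ M) ≡ orderings S (L ++ M)
  extend L M {short} =
    sum-orderings S L M (subst (length (L ++ M) <_) (sym ∣S∣≡6) (toWitness short))

  -- Marginal sums of the weights.

  same-diagonal : ∀ i j → pairWeight same i j i j ≡ orderings S (i ∷ j ∷ [])
  same-diagonal i j
    rewrite dec-true (i Fin.≟ i) refl | dec-true (j Fin.≟ j) refl = refl

  ∑-orderings : ∑² (λ i j → orderings S (i ∷ j ∷ [])) ≡ 720
  ∑-orderings = begin
    ∑² (λ i j → orderings S (i ∷ j ∷ []))  ≡⟨ sum-cong-≗ (λ i → extend (i ∷ []) []) ⟩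
    ∑[ i < n ] orderings S (i ∷ [])        ≡⟨ extend [] [] ⟩
    ∣ S ∣ !                                ≡⟨ cong _! ∣S∣≡6 ⟩
    720                                    ∎
    where open ≡-Reasoning

  -- For adjacent arcs the end `v` is forced to be `i`, which leaves `u` as the only new city. For
  -- distant arcs both cities are new and are summed out in turn.
  ∑-first : ∀ l i j → ∑² (λ u v → pairWeight (ahead l) u v i j) ≡ orderings S (i ∷ j ∷ [])
  ∑-first adjacent i j =
    trans (sum-cong-≗ (λ u → sum-≟ʳ i (λ v → orderings S (u ∷ v ∷ j ∷ []))))
          (extend [] (i ∷ j ∷ []))
  ∑-first distant i j =
    trans (sum-cong-≗ (λ u → extend (u ∷ []) (i ∷ j ∷ []))) (extend [] (i ∷ j ∷ []))

  -- Both sides count the orderings that begin with the cities of the first arc and then `t`. If the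
  -- stages are the same, `t` is the end `j` of that arc.
  ∑-flow : ∀ g i j t →
           ∑[ k < n ] pairWeight g i j k t ≡ ∑[ k < n ] pairWeight (grow g) i j t k
  ∑-flow behind i j t = refl
  ∑-flow same i j t = begin
    ∑[ k < n ] pairWeight same i j k t
      ≡⟨ sum-≟ˡ i _ ⟩
    when (does (j Fin.≟ t)) (orderings S (i ∷ j ∷ []))
      ≡⟨ cong (when (does (j Fin.≟ t))) (extend (i ∷ j ∷ []) []) ⟨
    when (does (j Fin.≟ t)) (∑[ k < n ] orderings S (i ∷ j ∷ k ∷ []))
      ≡⟨ sum-when n (does (j Fin.≟ t)) _ ⟨
    ∑[ k < n ] when (does (j Fin.≟ t)) (orderings S (i ∷ j ∷ k ∷ [])) ∎
    where open ≡-Reasoning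
  ∑-flow (ahead adjacent) i j t =
    trans (sum-≟ˡ j _) (sym (extend (i ∷ j ∷ t ∷ []) []))
  ∑-flow (ahead distant) i j t =
    trans (extend (i ∷ j ∷ []) (t ∷ [])) (sym (extend (i ∷ j ∷ t ∷ []) []))

  ∑-third : ∀ l l′ i j u v →
            ∑² (λ k t → tripleWeight (ahead l) (ahead l′) i j u v k t)
            ≡ pairWeight (ahead l) i j u v
  ∑-third adjacent l′ i j u v = begin
    ∑² (λ k t → when b (joined l′ v k (rest t)))  ≡⟨ sum-cong-≗ {n} (λ k → sum-when n b _) ⟩
    ∑[ k < n ] when b (∑[ t < n ] joined l′ v k (rest t))  ≡⟨ sum-when n b _ ⟩
    when b (∑² (λ k t → joined l′ v k (rest t)))  ≡⟨ cong (when b) (inner l′) ⟩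
    when b (orderings S (i ∷ j ∷ v ∷ []))         ∎
    where
    open ≡-Reasoning
    b = does (j Fin.≟ u)
    rest : Fin n → List (Fin n) → ℕ
    rest t m = orderings S (i ∷ j ∷ v ∷ m ++ t ∷ [])
    inner : ∀ l′ → ∑² (λ k t → joined l′ v k (rest t)) ≡ orderings S (i ∷ j ∷ v ∷ [])
    inner adjacent =
      trans (sum-cong-≗ (λ k → sum-when n (does (v Fin.≟ k)) _))
      (trans (sum-≟ˡ v _) (extend (i ∷ j ∷ v ∷ []) []))
    inner distant =
      trans (sum-cong-≗ (λ k → extend (i ∷ j ∷ v ∷ k ∷ []) [])) (extend (i ∷ j ∷ v ∷ []) [])
  ∑-third distant adjacent i j u v =
    trans (sum-cong-≗ (λ k → sum-when n (does (v Fin.≟ k)) _))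
    (trans (sum-≟ˡ v _) (extend (i ∷ j ∷ u ∷ v ∷ []) []))
  ∑-third distant distant i j u v =
    trans (sum-cong-≗ (λ k → extend (i ∷ j ∷ u ∷ v ∷ k ∷ []) [])) (extend (i ∷ j ∷ u ∷ v ∷ []) [])

  -- The middle arc separates the outer two, so the result is a distant pair for all links. An
  -- adjacent link determines one city of the middle arc, and a distant link leaves one to be summed
  -- out.
  ∑-second : ∀ l l′ i j k t →
             ∑² (λ u v → tripleWeight (ahead l) (ahead l′) i j u v k t)
             ≡ pairWeight (ahead distant) i j k t
  ∑-second adjacent l′ i j k t =
    trans (sum-cong-≗ (λ u → sum-when n (does (j Fin.≟ u)) _)) (trans (sum-≟ˡ j _) (inner l′))
    where
    inner : ∀ l′ → ∑[ v < n ] joined l′ v k (λ m → orderings S (i ∷ j ∷ v ∷ m ++ t ∷ []))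
                 ≡ orderings S (i ∷ j ∷ k ∷ t ∷ [])
    inner adjacent = sum-≟ʳ k _
    inner distant  = extend (i ∷ j ∷ []) (k ∷ t ∷ [])
  ∑-second distant adjacent i j k t =
    trans (sum-cong-≗ (λ u → sum-≟ʳ k (λ v → orderings S (i ∷ j ∷ u ∷ v ∷ t ∷ []))))
          (extend (i ∷ j ∷ []) (k ∷ t ∷ []))
  ∑-second distant distant i j k t =
    trans (sum-cong-≗ (λ u → extend (i ∷ j ∷ u ∷ []) (k ∷ t ∷ [])))
          (extend (i ∷ j ∷ []) (k ∷ t ∷ []))

  ∑-first₃ : ∀ l l′ u v k t →
             ∑² (λ i j → tripleWeight (ahead l) (ahead l′) i j u v k t)
             ≡ pairWeight (ahead l′) u v k t
  ∑-first₃ adjacent adjacent u v k t =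
    trans (sum-cong-≗ (λ i → sum-≟ʳ u (λ j → when (does (v Fin.≟ k)) (orderings S (i ∷ j ∷ v ∷ t ∷ [])))))
    (trans (sum-when n (does (v Fin.≟ k)) _)
           (cong (when (does (v Fin.≟ k))) (extend [] (u ∷ v ∷ t ∷ []))))
  ∑-first₃ adjacent distant u v k t =
    trans (sum-cong-≗ (λ i → sum-≟ʳ u (λ j → orderings S (i ∷ j ∷ v ∷ k ∷ t ∷ []))))
          (extend [] (u ∷ v ∷ k ∷ t ∷ []))
  ∑-first₃ distant adjacent u v k t =
    trans (sum-cong-≗ (λ i → trans (sum-when n (does (v Fin.≟ k)) _)
             (cong (when (does (v Fin.≟ k))) (extend (i ∷ []) (u ∷ v ∷ t ∷ [])))))
    (trans (sum-when n (does (v Fin.≟ k)) _)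
           (cong (when (does (v Fin.≟ k))) (extend [] (u ∷ v ∷ t ∷ []))))
  ∑-first₃ distant distant u v k t =
    trans (sum-cong-≗ (λ i → extend (i ∷ []) (u ∷ v ∷ k ∷ t ∷ [])))
          (extend [] (u ∷ v ∷ k ∷ t ∷ []))

  -- Vanishing on forbidden pairs.

  joined-0 : ∀ l {j u} (w : List (Fin n) → ℕ) →
             (j ≡ u → w [] ≡ 0) → w (u ∷ []) ≡ 0 → joined l j u w ≡ 0
  joined-0 adjacent {j} {u} w w₀ w₁ with j Fin.≟ u
  ... | yes j≡u = w₀ j≡u
  ... | no  _   = refl
  joined-0 distant w w₀ w₁ = w₁

  -- The two hypotheses treat the two lists that the link can produce: with `j` and `u` merged, and
  -- with both present.
  ahead-0 : ∀ l {i j u v} → (j ≡ u → Repeats (i ∷ j ∷ v ∷ [])) →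
            Repeats (i ∷ j ∷ u ∷ v ∷ []) → pairWeight (ahead l) i j u v ≡ 0
  ahead-0 l {i} {j} {u} {v} r₀ r₁ =
    joined-0 l (λ m → orderings S (i ∷ j ∷ m ++ v ∷ []))
      (λ j≡u → orderings-repeats S (i ∷ j ∷ v ∷ []) (r₀ j≡u)) (orderings-repeats S (i ∷ j ∷ u ∷ v ∷ []) r₁)

  same-0 : ∀ i j u v → (i ≡ u → j ≡ v → orderings S (i ∷ j ∷ []) ≡ 0) →
           pairWeight same i j u v ≡ 0
  same-0 i j u v z with i Fin.≟ u | j Fin.≟ v
  ... | yes i≡u | yes j≡v = z i≡u j≡v
  ... | yes _   | no  _   = refl
  ... | no  _   | _       = refl

  loopˡ-0 : ∀ g {i u v} → pairWeight g i i u v ≡ 0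
  loopˡ-0 behind    = refl
  loopˡ-0 same {i} {u} {v} = same-0 i i u v (λ _ _ → orderings-repeats S (i ∷ i ∷ []) (head (here refl)))
  loopˡ-0 (ahead l) = ahead-0 l (λ _ → head (here refl)) (head (here refl))

  loopʳ-0 : ∀ g {i j u} → pairWeight g i j u u ≡ 0
  loopʳ-0 behind    = refl
  loopʳ-0 same {i} {j} {u} = same-0 i j u u λ { refl refl → orderings-repeats S (u ∷ u ∷ []) (head (here refl)) }
  loopʳ-0 (ahead l) =
    ahead-0 l (λ { refl → tail (head (here refl)) }) (tail (tail (head (here refl))))

  broken-0 : ∀ {i j u v} → j ≢ u → pairWeight (ahead adjacent) i j u v ≡ 0
  broken-0 {j = j} {u} j≢u rewrite dec-false (j Fin.≟ u) j≢u = refl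

  -- Each condition makes the listed cities repeat, fails an equality test in the weight, or puts
  -- the stages in reverse order. The gap is a variable with an equation so that each clause can
  -- determine it by matching.
  forbidden-gap : ∀ {i s j u p v} → Forbidden n (i , s , j) (u , p , v) →
                  ∀ g → gap (# s) (# p) ≡ g → pairWeight g i j u v ≡ 0
  forbidden-gap (loop (inj₁ refl)) g _ = loopˡ-0 g
  forbidden-gap (loop (inj₂ refl)) g _ = loopʳ-0 g
  forbidden-gap (backward p<s) _ eq with refl ← trans (sym eq) (gap-> p<s) = refl
  forbidden-gap {i} {j = j} {u} {v = v} (clash p≡s ij≢uv) _ eq with refl ← trans (sym eq) (gap-≡ p≡s) =
    same-0 i j u v λ { refl refl → contradiction refl ij≢uv }
  forbidden-gap {i} {s} {v = v} (broken p≡s+1 j≢u) _ eq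
    -- The gap from `s` to `s + 1` is `grow same`, that is `ahead adjacent`.
    with refl ← trans (sym eq) (trans (gap-+1 {# s} {# s} ℕ.≤-refl p≡s+1) (cong grow (gap-≡ {# s} refl))) =
    broken-0 {i} {v = v} j≢u
  forbidden-gap (closing s<p refl _) _ eq
    with l , ahead-l ← gap-< s<p with refl ← trans (sym eq) ahead-l =
    ahead-0 l (λ _ → head (there (here refl))) (head (there (there (here refl))))
  forbidden-gap (releaving s<p refl) _ eq
    with l , ahead-l ← gap-< s<p with refl ← trans (sym eq) ahead-l =
    ahead-0 l (λ { refl → head (here refl) }) (head (there (here refl)))
  forbidden-gap (reentry s<p refl) _ eq
    with l , ahead-l ← gap-< s<p with refl ← trans (sym eq) ahead-l =
    ahead-0 l (λ _ → tail (head (here refl))) (tail (head (there (here refl))))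
  forbidden-gap {i} {s} {j} {p = p} {v} (revisit s+1<p refl) _ eq
    with refl ← trans (sym eq) (gap-<1+ (subst (_< # p) (ℕ.+-comm (# s) 1) s+1<p)) =
    orderings-repeats S (i ∷ j ∷ j ∷ v ∷ []) (tail (head (here refl)))

  forbidden-0 : ∀ {i s j u p v} → Forbidden n (i , s , j) (u , p , v) →
                pairWeight (gap (# s) (# p)) i j u v ≡ 0
  forbidden-0 f = forbidden-gap f _ refl

  -- Upper bounds, and the weights as functions of triples.

  orderings≤720 : ∀ L → orderings S L ≤ 720
  orderings≤720 L = subst (λ m → orderings S L ≤ m !) ∣S∣≡6 (orderings≤ S L)

  joined-≤ : ∀ l j u {w : List (Fin n) → ℕ} {b} → (∀ m → w m ≤ b) → joined l j u w ≤ b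
  joined-≤ adjacent j u w≤b = ℕ.≤-trans (when-≤ (does (j Fin.≟ u)) _) (w≤b _)
  joined-≤ distant  j u w≤b = w≤b _

  pairWeight≤720 : ∀ g i j u v → pairWeight g i j u v ≤ 720
  pairWeight≤720 behind    i j u v = z≤n
  pairWeight≤720 same      i j u v = ℕ.≤-trans (when-≤ (does (i Fin.≟ u)) _)
    (ℕ.≤-trans (when-≤ (does (j Fin.≟ v)) _) (orderings≤720 (i ∷ j ∷ [])))
  pairWeight≤720 (ahead l) i j u v = joined-≤ l j u (λ m → orderings≤720 (i ∷ j ∷ m ++ v ∷ []))

  tripleWeight≤720 : ∀ g g′ i j u v k t → tripleWeight g g′ i j u v k t ≤ 720
  tripleWeight≤720 (ahead l) (ahead l′) i j u v k t =
    joined-≤ l j u λ m → joined-≤ l′ v k λ m′ → orderings≤720 (i ∷ j ∷ m ++ v ∷ m′ ++ t ∷ [])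
  tripleWeight≤720 (ahead l) behind     i j u v k t = z≤n
  tripleWeight≤720 (ahead l) same       i j u v k t = z≤n
  tripleWeight≤720 behind    _          i j u v k t = z≤n
  tripleWeight≤720 same      _          i j u v k t = z≤n

  pairAt : Triple n → Triple n → ℕ
  pairAt (i , s , j) (u , p , v) = pairWeight (gap (# s) (# p)) i j u v

  tripleAt : Triple n → Triple n → Triple n → ℕ
  tripleAt (i , s , j) (u , p , v) (k , r , t) =
    tripleWeight (gap (# s) (# p)) (gap (# p) (# r)) i j u v k t

  module _ {s p r : Fin n} (s<p : # s < # p) (p<r : # p < # r) where

    third : ∀ i j u v → ∑² (λ k t → tripleAt (i , s , j) (u , p , v) (k , r , t))
                        ≡ pairAt (i , s , j) (u , p , v)
    third i j u v with l , eq ← gap-< s<p | l′ , eq′ ← gap-< p<r rewrite eq | eq′ =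
      ∑-third l l′ i j u v

    second : ∀ i j k t → ∑² (λ u v → tripleAt (i , s , j) (u , p , v) (k , r , t))
                         ≡ pairAt (i , s , j) (k , r , t)
    second i j k t with l , eq ← gap-< s<p | l′ , eq′ ← gap-< p<r
      rewrite eq | eq′ | gap-<< s<p p<r = ∑-second l l′ i j k t

    first : ∀ u v k t → ∑² (λ i j → tripleAt (i , s , j) (u , p , v) (k , r , t))
                        ≡ pairAt (u , p , v) (k , r , t)
    first u v k t with l , eq ← gap-< s<p | l′ , eq′ ← gap-< p<r rewrite eq | eq′ =
      ∑-first₃ l l′ u v k t

  tripleAt-stages : ∀ i s j u p v k r t →
    tripleAt (i , s , j) (u , p , v) (k , r , t) ≢ 0 → # s < # p × # p < # r
  tripleAt-stages i s j u p v k r t ≢0 with gap (# s) (# p) in eq | gap (# p) (# r) in eq′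
  ... | ahead l | ahead l′ = gap-ahead (# s) (# p) eq , gap-ahead (# p) (# r) eq′
  ... | ahead l | behind   = contradiction refl ≢0
  ... | ahead l | same     = contradiction refl ≢0
  ... | behind  | _        = contradiction refl ≢0
  ... | same    | _        = contradiction refl ≢0

  -- A marginal of tripleAt bounds it, so tripleAt vanishes wherever pairAt does.
  tripleAt-0 : ∀ i s j u p v k r t →
    ¬ ((# s < # p × # p < # r)
       × ¬ Forbidden n (i , s , j) (u , p , v)
       × ¬ Forbidden n (i , s , j) (k , r , t)
       × ¬ Forbidden n (u , p , v) (k , r , t)) →
    tripleAt (i , s , j) (u , p , v) (k , r , t) ≡ 0
  tripleAt-0 i s j u p v k r t illegal
    with tripleAt (i , s , j) (u , p , v) (k , r , t) ℕ.≟ 0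
  ... | yes ≡0 = ≡0
  ... | no  ≢0 = contradiction
      ( (s<p , p<r)
      , (λ f → ≢0 (bounded (term≤∑² _ k t) (trans (third s<p p<r i j u v) (forbidden-0 f))))
      , (λ f → ≢0 (bounded (term≤∑² (λ u v → tripleAt (i , s , j) (u , p , v) (k , r , t)) u v)
                           (trans (second s<p p<r i j k t) (forbidden-0 f))))
      , (λ f → ≢0 (bounded (term≤∑² (λ i j → tripleAt (i , s , j) (u , p , v) (k , r , t)) i j)
                           (trans (first s<p p<r u v k t) (forbidden-0 f)))))
      illegal
    where
    stages = tripleAt-stages i s j u p v k r t ≢0
    s<p = proj₁ stages
    p<r = proj₂ stages
    bounded : ∀ {a b} → a ≤ b → b ≡ 0 → a ≡ 0
    bounded a≤b b≡0 = ℕ.n≤0⇒n≡0 (subst (_ ≤_) b≡0 a≤b)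

-- Reals that are multiples of 1 / 720

scale : ℕ → ℚ
scale k = k ×ℚ (ℤ.+ 1 ℚ./ 720)

infix 4 _≐_

-- All reals of the construction are constant sequences, so equations between them reduce to
-- equations between natural numbers. The record keeps `x` and `k` inferable.
record _≐_ (x : ℝ) (k : ℕ) : Set where
  constructor constantly
  field
    at : ∀ m → seq x m ≡ scale k

open _≐_

scale-mono : ∀ {k l} → k ≤ l → scale k ℚ.≤ scale l
scale-mono {l = zero}  z≤n       = ℚ.≤-refl
scale-mono {l = suc l} z≤n       =
  ℚ.+-mono-≤ (ℚ.nonNegative⁻¹ (ℤ.+ 1 ℚ./ 720)) (scale-mono {l = l} z≤n)
scale-mono             (s≤s k≤l) = ℚ.+-monoʳ-≤ (ℤ.+ 1 ℚ./ 720) (scale-mono k≤l)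

1≐720 : 1ℝ ≐ 720
-- By computation: 720 copies of 1/720 add up to 1.
1≐720 = constantly λ _ → refl

0≐0 : 0ℝ ≐ 0
0≐0 = constantly λ _ → refl

≐-sum : ∀ {n} {f : Fin n → ℝ} {g : Fin n → ℕ} → (∀ i → f i ≐ g i) → Real.sum f ≐ sum g
≐-sum {zero}          f≐g = 0≐0
≐-sum {suc n} {f} {g} f≐g = constantly λ m →
  trans (cong₂ ℚ._+_ (at (f≐g zero) m) (at (≐-sum (f≐g ∘ suc)) m)) (sym (×-homo-+ _ (g zero) _))

≐-· : ∀ c {x k} → x ≐ k → c · x ≐ c * k
≐-· zero            x≐k = 0≐0
≐-· (suc c) {k = k} x≐k = constantly λ m →
  trans (cong₂ ℚ._+_ (at x≐k m) (at (≐-· c x≐k) m)) (sym (×-homo-+ _ k _))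

≐⇒≈ : ∀ {x y k} → x ≐ k → y ≐ k → x ≈ y
≐⇒≈ {k = k} x≐k y≐k ε = 0 , λ m _ →
  subst (ℚ._≤ ε) (sym (trans (cong₂ (λ p q → ℚ.∣ p ℚ.- q ∣) (at x≐k m) (at y≐k m))
                             (cong ℚ.∣_∣ (ℚ.+-inverseʳ (scale k)))))
        (ℚ.<⇒≤ (ℚ.positive⁻¹ ε))

≐⇒≤ : ∀ {x y k l} → x ≐ k → y ≐ l → k ≤ l → x Real.≤ y
≐⇒≤ {x} {y} {k} {l} x≐k y≐l k≤l ε = 0 , λ m _ → begin
  seq x m            ≡⟨ at x≐k m ⟩
  scale k            ≤⟨ scale-mono k≤l ⟩
  scale l            ≡⟨ at y≐l m ⟨
  seq y m            ≡⟨ ℚ.+-identityʳ _ ⟨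
  seq y m ℚ.+ 0ℚ     ≤⟨ ℚ.+-monoʳ-≤ (seq y m) (ℚ.<⇒≤ (ℚ.positive⁻¹ ε)) ⟩
  seq y m ℚ.+ ε      ∎
  where open ℚ.≤-Reasoning

-- The feasible point and its cost.

module Solution {n} (S : Subset n) (∣S∣≡6 : ∣ S ∣ ≡ 6) where

  open Weights S ∣S∣≡6

  fraction : ℕ → ℝ
  fraction k = Real.fromℚ (scale k)

  fraction-≐ : ∀ k → fraction k ≐ k
  fraction-≐ k = constantly λ _ → refl

  point : Point n
  point = record
    { y = λ a b → fraction (pairAt a b)
    ; z = λ a b c → fraction (tripleAt a b c)
    }

  inUnitInterval : ∀ {k} → k ≤ 720 → InUnitInterval n (fraction k)
  inUnitInterval {k} k≤720 =
    ≐⇒≤ 0≐0 (fraction-≐ k) z≤n , ≐⇒≤ (fraction-≐ k) 1≐720 k≤720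

  diagonal : ∀ i s j → pairAt (i , s , j) (i , s , j) ≡ orderings S (i ∷ j ∷ [])
  diagonal i s j = trans (cong (λ g → pairWeight g i j i j) (gap-≡ {# s} refl)) (same-diagonal i j)

  fraction≈0 : ∀ {k} → k ≡ 0 → fraction k ≈ 0ℝ
  fraction≈0 refl = ≐⇒≈ (fraction-≐ 0) 0≐0

  ∑-fraction : ∀ {f : Fin n → ℕ} {k} → sum f ≡ k → Real.sum (λ i → fraction (f i)) ≐ k
  ∑-fraction {f} refl = ≐-sum (λ i → fraction-≐ (f i))

  ∑²-fraction : ∀ {f : Fin n → Fin n → ℕ} {k} → ∑² f ≡ k →
                Real.sum (λ i → Real.sum (λ j → fraction (f i j))) ≐ k
  ∑²-fraction {f} refl = ≐-sum (λ i → ∑-fraction {f i} refl)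

  feasible : Feasible n point
  feasible = record
    { y-bounds  = λ (i , s , j) (u , p , v) →
                    inUnitInterval (pairWeight≤720 (gap (# s) (# p)) i j u v)
    ; z-bounds  = λ (i , s , j) (u , p , v) (k , r , t) →
                    inUnitInterval
                      (tripleWeight≤720 (gap (# s) (# p)) (gap (# p) (# r)) i j u v k t)
    ; y-zero    = λ _ _ f → fraction≈0 (forbidden-0 f)
    ; z-zero    = λ i s j u p v k r t illegal →
                    fraction≈0 (tripleAt-0 i s j u p v k r t illegal)
    ; initial   = λ s _ →
        ≐⇒≈ (∑²-fraction (trans (∑²-cong (λ i j → diagonal i s j)) ∑-orderings)) 1≐720
    ; spread    = λ i j s s₁ s₁≡1 2≤s →
        ≐⇒≈ (fraction-≐ _) (∑²-fraction (spread i j s s₁ s₁≡1 2≤s))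
    ; flow      = λ i j t s r r⁺ s≤r r⁺≡r+1 →
        ≐⇒≈ (∑-fraction (flow i j t s r r⁺ s≤r r⁺≡r+1)) (∑-fraction refl)
    ; marginal₃ = λ i j u v s p r s<p p<r →
        ≐⇒≈ (∑²-fraction (third s<p p<r i j u v)) (fraction-≐ _)
    ; marginal₂ = λ i j k t s p r s<p p<r →
        ≐⇒≈ (∑²-fraction (second s<p p<r i j k t)) (fraction-≐ _)
    ; marginal₁ = λ u v k t s p r s<p p<r →
        ≐⇒≈ (∑²-fraction (first s<p p<r u v k t)) (fraction-≐ _)
    }
    where
    spread : ∀ i j s s₁ → # s₁ ≡ 1 → 2 ≤ # s →
             ∑² (λ u v → pairAt (u , s₁ , v) (i , s , j)) ≡ pairAt (i , s , j) (i , s , j)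
    spread i j s s₁ s₁≡1 2≤s
      with l , eq ← gap-< (subst (_< # s) (sym s₁≡1) 2≤s) rewrite eq =
      trans (∑-first l i j) (sym (diagonal i s j))

    flow : ∀ i j t s r r⁺ → # s ≤ # r → # r⁺ ≡ # r + 1 →
           ∑[ k < n ] pairAt (i , s , j) (k , r , t) ≡ ∑[ k < n ] pairAt (i , s , j) (t , r⁺ , k)
    flow i j t s r r⁺ s≤r r⁺≡r+1 rewrite gap-+1 s≤r r⁺≡r+1 = ∑-flow (gap (# s) (# r)) i j t

  module _ (c : Fin n → Fin n → ℕ)
           (c≡1 : ∀ i j → lookup S i ≡ inside → lookup S j ≡ inside → c i j ≡ 1) where

    -- The weight is zero unless both cities lie in `S`, where the cost factor is 1. The skipped
    -- diagonal terms have weight zero because the city repeats.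
    term-≐ : ∀ s i j →
      (if does (i Fin.≟ j) then 0ℝ else c i j · fraction (pairAt (i , s , j) (i , s , j)))
        ≐ orderings S (i ∷ j ∷ [])
    term-≐ s i j with i Fin.≟ j
    ... | yes refl = subst (0ℝ ≐_) (sym (orderings-repeats S (i ∷ i ∷ []) (head (here refl)))) 0≐0
    ... | no  i≢j  = subst (c i j · fraction (pairAt (i , s , j) (i , s , j)) ≐_)
      (trans (cong (c i j *_) (diagonal i s j)) (weighted _ _ refl refl))
      (≐-· (c i j) (fraction-≐ _))
      where
      w = orderings S (i ∷ j ∷ [])
      outside-S : w ≡ 0 → c i j * w ≡ w
      outside-S w≡0 = trans (cong (c i j *_) w≡0) (trans (ℕ.*-zeroʳ (c i j)) (sym w≡0))
      weighted : ∀ b b′ → lookup S i ≡ b → lookup S j ≡ b′ → c i j * w ≡ w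
      weighted true  true  i∈S j∈S = trans (cong (_* w) (c≡1 i j i∈S j∈S)) (ℕ.*-identityˡ w)
      weighted true  false _   j∉S = outside-S (orderings-absent S (i ∷ j ∷ []) j∉S (there (here refl)))
      weighted false _     i∉S _   = outside-S (orderings-absent S (i ∷ j ∷ []) i∉S (here refl))

    blpCost-point : ∀ m → seq (blpCost n c (point , feasible)) m ≡ n ×ℚ 1ℚ
    -- Regroups `n * 720` copies of 1/720 as `n` blocks, each of which computes to 1.
    blpCost-point m = trans (at total≐ m) (sym (×-assocˡ (ℤ.+ 1 ℚ./ 720) n 720))
      where
      total : ∑[ s < n ] ∑² (λ i j → orderings S (i ∷ j ∷ [])) ≡ n * 720
      total = trans (sum-cong-≗ {n} (λ _ → ∑-orderings)) (sum-const n 720)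
      total≐ : blpCost n c (point , feasible) ≐ n * 720
      total≐ = subst (blpCost n c (point , feasible) ≐_) total
        (≐-sum (λ s → ≐-sum (λ i → ≐-sum (λ j → term-≐ s i j))))

    cheapPoint : ∀ k → n ×ℚ 1ℚ ℚ.+ 1ℚ ℚ.≤ ℤ.+ k ℚ./ 1 →
                 ∃[ x ] blpCost n c x Real.< Real.fromℕ k
    -- The strict inequality holds with margin 1 from index 0 on, since the cost is constantly `n`.
    cheapPoint k n+1≤k = (point , feasible) , 1ℚ , _ , 0 , λ m _ →
      subst (λ p → p ℚ.+ 1ℚ ℚ.≤ ℤ.+ k ℚ./ 1) (sym (blpCost-point m)) n+1≤k

-- Tours

-- The part of an arc's cost above 1: an arc between valleys costs 1000 = 1 + 999.
excess : ∀ {m} → Fin m → Fin m → ℕ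
excess v w = if does (v Fin.≟ w) then 0 else 999

excess-≢ : ∀ {m} {v w : Fin m} → v ≢ w → excess v w ≡ 999
excess-≢ {v = v} {w} v≢w rewrite dec-false (v Fin.≟ w) v≢w = refl

next : ∀ {n} .{{_ : NonZero n}} → Fin n → Fin n
next {n} k = suc (toℕ k) mod n

suc-mod : ∀ n .{{_ : NonZero n}} t → suc t mod n ≡ next (t mod n)
suc-mod n t = Fin.toℕ-injective (begin
  toℕ (suc t mod n)            ≡⟨ Fin.toℕ-fromℕ< _ ⟩
  (1 + t) % n                  ≡⟨ DivMod.%-distribˡ-+ 1 t n ⟩
  (1 % n + t % n) % n          ≡⟨ cong (λ r → (1 % n + r) % n) (DivMod.m%n%n≡m%n t n) ⟨
  (1 % n + t % n % n) % n      ≡⟨ DivMod.%-distribˡ-+ 1 (t % n) n ⟨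
  suc (t % n) % n              ≡⟨ cong (λ r → suc r % n) (Fin.toℕ-fromℕ< (DivMod.m%n<n t n)) ⟨
  suc (toℕ (t mod n)) % n      ≡⟨ Fin.toℕ-fromℕ< _ ⟨
  toℕ (next (t mod n))         ∎)
  where open ≡-Reasoning

toℕ-mod : ∀ {n} .{{_ : NonZero n}} (k : Fin n) → toℕ k mod n ≡ k
toℕ-mod {n} k = Fin.toℕ-injective
  (trans (Fin.toℕ-fromℕ< _) (DivMod.m<n⇒m%n≡m (Fin.toℕ<n k)))

toℕ+n-mod : ∀ {n} .{{_ : NonZero n}} (k : Fin n) → (n + toℕ k) mod n ≡ k
toℕ+n-mod {n} k = Fin.toℕ-injective (begin
  toℕ ((n + toℕ k) mod n)  ≡⟨ Fin.toℕ-fromℕ< _ ⟩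
  (n + toℕ k) % n          ≡⟨ cong (_% n) (ℕ.+-comm n (toℕ k)) ⟩
  (toℕ k + n) % n          ≡⟨ DivMod.[m+n]%n≡m%n (toℕ k) n ⟩
  toℕ k % n                ≡⟨ DivMod.m<n⇒m%n≡m (Fin.toℕ<n k) ⟩
  toℕ k                    ∎)
  where open ≡-Reasoning

-- Residues of consecutive naturals are related by `next`, so ordinary induction applies. It runs
-- from `toℕ k` up to `n + toℕ l`, which is not smaller and has residue `l`.
cyclic-induction : ∀ {n} .{{_ : NonZero n}} (P : Fin n → Set) →
                   (∀ k → P k → P (next k)) → ∀ {k} → P k → ∀ l → P l
cyclic-induction {n} P step {k} Pk l =
  subst P (toℕ+n-mod l)
    (upward (ℕ.≤⇒≤′ (ℕ.≤-trans (ℕ.<⇒≤ (Fin.toℕ<n k)) (ℕ.m≤m+n n (toℕ l)))))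
  where
  upward : ∀ {t} → toℕ k ℕ.≤′ t → P (t mod n)
  upward ℕ.≤′-refl        = subst P (sym (toℕ-mod k)) Pk
  upward (ℕ.≤′-step k≤′t) = subst P (sym (suc-mod n _)) (step _ (upward k≤′t))

-- If no step left the value `a`, cyclic induction would carry it from `k` round to `l`.
leaving : ∀ {n} .{{_ : NonZero n}} {A : Set} (_≟_ : DecidableEquality A) (f : Fin n → A)
          {k l a} → f k ≡ a → f l ≢ a → ∃[ m ] f m ≡ a × f (next m) ≢ a
leaving _≟_ f {k} {l} {a} fk≡a fl≢a
  with Fin.any? (λ m → f m ≟ a ×-dec ¬? (f (next m) ≟ a))
... | yes found = found
... | no  none  = contradiction (cyclic-induction (λ m → f m ≡ a) stay fk≡a l) fl≢a
  where
  stay : ∀ m → f m ≡ a → f (next m) ≡ a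
  stay m fm≡a = decidable-stable (f (next m) ≟ a) (λ ≢a → none (m , fm≡a , ≢a))

module _ {n m} .{{_ : NonZero n}} {c : Fin n → Fin n → ℕ} (region : Fin n → Fin (2 + m))
         (c-excess : ∀ i j → c i j ≡ 1 + excess (region i) (region j))
         (city : Fin (2 + m) → Fin n) (region-city : ∀ v → region (city v) ≡ v) where

  -- Double counting: every region has an exit arc, to which it charges 999. Each arc starts in
  -- exactly one region, so after exchanging the sums no arc is charged more than its own excess.
  tourCost-lowerBound : ∀ σ → n * 1 + (2 + m) * 999 ≤ tourCost n c σ
  tourCost-lowerBound σ = begin
    n * 1 + (2 + m) * 999
      ≡⟨ cong₂ _+_ (sum-const n 1) (sum-const (2 + m) 999) ⟨
    ∑[ k < n ] 1 + ∑[ v < 2 + m ] 999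
      ≡⟨ cong (∑[ k < n ] 1 +_) (sum-cong-≗ (λ v → sum-≟ˡ (exit v) (λ _ → 999))) ⟨
    ∑[ k < n ] 1 + ∑[ v < 2 + m ] ∑[ k < n ] when (does (exit v Fin.≟ k)) 999
      ≡⟨ cong (∑[ k < n ] 1 +_) (∑-comm (λ v k → when (does (exit v Fin.≟ k)) 999)) ⟩
    ∑[ k < n ] 1 + ∑[ k < n ] ∑[ v < 2 + m ] when (does (exit v Fin.≟ k)) 999
      ≤⟨ ℕ.+-monoʳ-≤ (∑[ k < n ] 1) (sum-mono-≤ {n} (λ k → sum-mono-≤ {2 + m} (λ v → charge v k))) ⟩
    ∑[ k < n ] 1 + ∑[ k < n ] ∑[ v < 2 + m ] when (does (loc k Fin.≟ v)) (jump k)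
      ≡⟨ cong (∑[ k < n ] 1 +_) (sum-cong-≗ (λ k → sum-≟ˡ (loc k) (λ _ → jump k))) ⟩
    ∑[ k < n ] 1 + ∑[ k < n ] jump k
      ≡⟨ ∑-distrib-+ {n} (λ _ → 1) jump ⟨
    ∑[ k < n ] (1 + jump k)
      ≡⟨ sum-cong-≗ {n} (λ k → c-excess (σ ⟨$⟩ʳ k) (σ ⟨$⟩ʳ next k)) ⟨
    tourCost n c σ ∎
    where
    open ℕ.≤-Reasoning
    loc : Fin n → Fin (2 + m)
    loc k = region (σ ⟨$⟩ʳ k)
    jump : Fin n → ℕ
    jump k = excess (loc k) (loc (next k))
    visited : ∀ v → loc (σ ⟨$⟩ˡ city v) ≡ v
    visited v = trans (cong region (inverseʳ σ)) (region-city v)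
    exits : ∀ v → ∃[ k ] loc k ≡ v × loc (next k) ≢ v
    exits v = leaving Fin._≟_ loc (visited v)
      -- `punchIn v zero` is a region other than `v`. It exists because there are at least two
      -- regions, and the tour visits it.
      (λ eq → Fin.punchInᵢ≢i v zero (trans (sym (visited (punchIn v zero))) eq))
    exit : Fin (2 + m) → Fin n
    exit v = proj₁ (exits v)
    -- An exit of v is charged to the excess of that one arc, which starts in v.
    charge : ∀ v k → when (does (exit v Fin.≟ k)) 999 ≤ when (does (loc k Fin.≟ v)) (jump k)
    charge v k with exit v Fin.≟ k
    ... | no  _    = z≤n
    ... | yes refl with k∈v , next∉v ← proj₂ (exits v)
      rewrite dec-true (loc k Fin.≟ v) k∈v =
      ℕ.≤-reflexive (sym (excess-≢ (λ eq → next∉v (trans (sym eq) k∈v))))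

-- The least tour cost of the four-valley instance.

valleyCost-excess : ∀ i j → valleyCost i j ≡ 1 + excess (valley i) (valley j)
valleyCost-excess i j with does (valley i Fin.≟ valley j)
... | true  = refl
... | false = refl

-- The first city of each valley: 1, 5, 17 and 29, with indices counted from 0.
city : Fin 4 → Fin 32
city 0F = 0 mod 32
city 1F = 4 mod 32
city 2F = 16 mod 32
city 3F = 28 mod 32

valley-city : ∀ v → valley (city v) ≡ v
valley-city 0F = refl
valley-city 1F = refl
valley-city 2F = refl
valley-city 3F = refl

-- The identity tour passes through the valleys one after another and attains the bound: 28 + 4 ·
-- 1000 = 32 + 4 · 999.
isMinTourCost : IsMinTourCost 32 valleyCost 4028
isMinTourCost =
  (Perm.id , refl) , tourCost-lowerBound {m = 2} {valleyCost} valley valleyCost-excess city valley-city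

-- The optimal values differ

p≤∣p∣ : ∀ p → p ℚ.≤ ℚ.∣ p ∣
p≤∣p∣ p with ℚ.≤-total 0ℚ p
... | inj₁ 0≤p = ℚ.≤-reflexive (sym (ℚ.0≤p⇒∣p∣≡p 0≤p))
... | inj₂ p≤0 = ℚ.≤-trans p≤0 (ℚ.0≤∣p∣ p)

p≤q+∣q-p∣ : ∀ p q → p ℚ.≤ q ℚ.+ ℚ.∣ q ℚ.- p ∣
p≤q+∣q-p∣ p q = begin
  p                        ≡⟨ xyx⁻¹≈y q p ⟨
  q ℚ.+ p ℚ.- q            ≡⟨ ℚ.+-assoc q p (ℚ.- q) ⟩
  q ℚ.+ (p ℚ.- q)          ≤⟨ ℚ.+-monoʳ-≤ q (p≤∣p∣ (p ℚ.- q)) ⟩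
  q ℚ.+ ℚ.∣ p ℚ.- q ∣      ≡⟨ cong (λ r → q ℚ.+ ℚ.∣ r ∣) (⁻¹-anti-homo-// q p) ⟨
  q ℚ.+ ℚ.∣ ℚ.- (q ℚ.- p) ∣ ≡⟨ cong (q ℚ.+_) (ℚ.∣-p∣≡∣p∣ (q ℚ.- p)) ⟩
  q ℚ.+ ℚ.∣ q ℚ.- p ∣      ∎
  where open ℚ.≤-Reasoning

half+half : ∀ p → ½ ℚ.* p ℚ.+ ½ ℚ.* p ≡ p
half+half p = trans (sym (ℚ.*-distribʳ-+ p ½ ½)) (ℚ.*-identityˡ p)

half< : ∀ p .{{_ : ℚ.Positive p}} → ½ ℚ.* p ℚ.< p
half< p = subst (½ ℚ.* p ℚ.<_) (ℚ.*-identityˡ p)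
            (ℚ.*-monoˡ-<-pos p (toWitness {a? = ½ ℚ.<? 1ℚ} _))

-- If `v` were equal to `y`, then at an index beyond all three thresholds `y` would exceed `x` by at
-- most half of the margin `ε` that separates them.
≤-<⇒≉ : ∀ {v x y} → v Real.≤ x → x Real.< y → ¬ (v ≈ y)
≤-<⇒≉ {v} {x} {y} v≤x (ε , ε>0 , K , x+ε≤y) v≈y =
  ℚ.<-irrefl refl (begin-strict
    seq y n                        ≤⟨ p≤q+∣q-p∣ (seq y n) (seq v n) ⟩
    seq v n ℚ.+ ℚ.∣ seq v n ℚ.- seq y n ∣
      ≤⟨ ℚ.+-mono-≤ (proj₂ v≤x+δ n L≤n) (proj₂ v-y≤δ n M≤n) ⟩
    seq x n ℚ.+ δ ℚ.+ δ            ≡⟨ ℚ.+-assoc (seq x n) δ δ ⟩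
    seq x n ℚ.+ (δ ℚ.+ δ)          ≡⟨ cong (seq x n ℚ.+_) (half+half (½ ℚ.* ε)) ⟩
    seq x n ℚ.+ ½ ℚ.* ε            <⟨ ℚ.+-monoʳ-< (seq x n) (half< ε) ⟩
    seq x n ℚ.+ ε                  ≤⟨ x+ε≤y n K≤n ⟩
    seq y n                        ∎)
  where
  open ℚ.≤-Reasoning
  instance
    _ : ℚ.Positive ε
    _ = ε>0
    ½ε>0 : ℚ.Positive (½ ℚ.* ε)
    ½ε>0 = ℚ.pos*pos⇒pos ½ ε
    δ>0 : ℚ.Positive (½ ℚ.* (½ ℚ.* ε))
    δ>0 = ℚ.pos*pos⇒pos ½ (½ ℚ.* ε)
  -- A quarter of the margin, spent twice: once on `v≤x` and once on `v≈y`.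
  δ = ½ ℚ.* (½ ℚ.* ε)
  v≤x+δ = v≤x δ
  v-y≤δ = v≈y δ
  L = proj₁ v≤x+δ
  M = proj₁ v-y≤δ
  n = K ℕ.⊔ (L ℕ.⊔ M)
  K≤n = ℕ.m≤m⊔n K (L ℕ.⊔ M)
  L≤n = ℕ.≤-trans (ℕ.m≤m⊔n L M) (ℕ.m≤n⊔m K (L ℕ.⊔ M))
  M≤n = ℕ.≤-trans (ℕ.m≤n⊔m L M) (ℕ.m≤n⊔m K (L ℕ.⊔ M))

infimum≉ : ∀ {X : Set} {f : X → ℝ} {v y} → ∃[ x ] f x Real.< y → IsInfimum f v → ¬ (v ≈ y)
infimum≉ {f = f} {v} {y} (x , fx<y) (v≤f , _) = ≤-<⇒≉ {v} {f x} {y} (v≤f x) fx<y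

-- The cheap point in the second valley.

support : Subset 32
-- Cities 5 to 10, six of the twelve in valley B. The valleys A and D, with four cities each, would
-- be too small.
support = tabulate (λ i → does (5 ℕ.≤? # i ×-dec # i ℕ.≤? 10))

support-valley : ∀ i → lookup support i ≡ inside → valley i ≡ 1F
support-valley =
  toWitness {a? = Fin.all? (λ i → (lookup support i Bool.≟ inside) →-dec (valley i Fin.≟ 1F))} _

support-cost : ∀ i j → lookup support i ≡ inside → lookup support j ≡ inside →
               valleyCost i j ≡ 1
support-cost i j i∈S j∈S =
  cong₂ (λ v w → if does (v Fin.≟ w) then 1 else 1000) (support-valley i i∈S) (support-valley j j∈S)

cheapValleyPoint : ∃[ x ] blpCost 32 valleyCost x Real.< Real.fromℕ 4028
cheapValleyPoint = Solution.cheapPoint support refl valleyCost support-cost 4028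
  (toWitness {a? = 32 ×ℚ 1ℚ ℚ.+ 1ℚ ℚ.≤? ℤ.+ 4028 ℚ./ 1} _)

mainTheorem1 : ∃[ m ] IsMinTourCost 32 valleyCost m
    × (∃[ x ] blpCost 32 valleyCost x Real.< Real.fromℕ m)
    × (∀ v → IsBLPOptimum 32 valleyCost v → ¬ (v Real.≈ Real.fromℕ m))
mainTheorem1 =
  4028 , isMinTourCost , cheapValleyPoint ,
  λ v → infimum≉ {f = blpCost 32 valleyCost} {v} {Real.fromℕ 4028} cheapValleyPoint
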